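{- Let $h$ be a positive integer, let $S$ be an arbitrary set of positive integers, and let $S'=\mathbb{N}_+\setminus\{mh\mid m\in\mathbb{N}_+\setminus S\}$. Then for every integer $n\ge 0$, $$G_{S'}(n)=G_S\left(\left\lfloor\frac{n}{h}\right\rfloor\right)h+(n\bmod h).$$
   Context: $\mathbb{N}_+$ denotes the set of positive integers. For a finite set $T$ of non-negative integers, $\mathrm{mex}\,T$ is the least non-negative integer not in $T$. For a set $S$ of positive integers, $\mathrm{Subtraction}(S)$ is the impartial normal-play game on a single heap, where a move takes a heap of $x$ tokens to a heap of $x-s$ tokens for some $s\in S$ with $s\le x$. Its $\mathcal{G}$-value sequence $G_S$ is defined recursively by $G_S(x)=\mathrm{mex}\{G_S(x-s)\mid s\in S,\ s\le x\}$ for $x=0,1,2,\ldots$. -}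

module Defs where

open import Data.Nat using (ℕ; zero; suc; _+_; _∸_; _*_; _≤_; _<_; NonZero; z≤n; s≤s)
open import Data.Nat.Induction using (<-rec)
open import Data.Nat.Properties
open import Data.Product using (∃; _×_; _,_; proj₁; proj₂)
open import Data.Sum using (inj₁; inj₂)
open import Level using (Level; 0ℓ)
open import Relation.Binary.PropositionalEquality using (_≡_; refl; sym; trans; subst)
open import Relation.Nullary using (yes; no; contradiction)
open import Relation.Nullary.Decidable using (map′; _×-dec_; ¬?)
open import Relation.Unary using (Pred; Decidable; _∈_; _∉_; _⊆_; _∖_)

private variable
  ℓ : Level

ℕ₊ : Pred ℕ 0ℓ
ℕ₊ n = 0 < n

-- Being the mex of T is a relation, because T is an arbitrary predicate and a
-- function computing the mex would require T to be decidable.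
IsMex : Pred ℕ ℓ → ℕ → Set ℓ
IsMex T v = v ∉ T × (∀ u → u ∉ T → v ≤ u)

-- The set { g (x - s) ∣ s ∈ S, s ≤ x }.  The bound s ≤ x makes the truncated
-- subtraction exact.
optionValues : Pred ℕ ℓ → (ℕ → ℕ) → ℕ → Pred ℕ ℓ
optionValues S g x u = ∃ λ s → s ∈ S × s ≤ x × u ≡ g (x ∸ s)

-- "g is the 𝒢-value sequence of Subtraction(S)": g satisfies the defining
-- recursion at every heap size.  For S ⊆ ℕ₊ this determines g
-- (gSequence-unique), and for decidable S such a g exists (gSequence-exists);
-- classically, every S is decidable.
IsGSequence : Pred ℕ ℓ → (ℕ → ℕ) → Set ℓ
IsGSequence S g = ∀ x → IsMex (optionValues S g x) (g x)

multiples : ℕ → Pred ℕ ℓ → Pred ℕ ℓ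
multiples h T n = ∃ λ m → m ∈ T × n ≡ m * h

infix 8 _′[_]

_′[_] : Pred ℕ ℓ → ℕ → Pred ℕ ℓ
S ′[ h ] = ℕ₊ ∖ multiples h (ℕ₊ ∖ S)

isMex-unique : ∀ {T : Pred ℕ ℓ} {v w} → IsMex T v → IsMex T w → v ≡ w
isMex-unique (v∉T , v-least) (w∉T , w-least) =
  ≤-antisym (v-least _ w∉T) (w-least _ v∉T)

isMex-exists : ∀ {T : Pred ℕ ℓ} → Decidable T → ∀ {u} → u ∉ T → ∃ (IsMex T)
isMex-exists {T = T} T? {u} =
  <-rec (λ u → u ∉ T → ∃ (IsMex T)) step u
  where
  step : ∀ u → (∀ {w} → w < u → w ∉ T → ∃ (IsMex T)) → u ∉ T → ∃ (IsMex T)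
  step u rec u∉T with anyUpTo? (λ w → ¬? (T? w)) u
  ... | yes (w , w<u , w∉T) = rec w<u w∉T
  ... | no none = u , u∉T , λ w w∉T → ≮⇒≥ λ w<u → none (w , w<u , w∉T)

module _ {S : Pred ℕ ℓ} (S⊆ℕ₊ : S ⊆ ℕ₊) where

  private
    optionValues-mono : ∀ {g g′ x} → (∀ {y} → y < x → g y ≡ g′ y) →
                        optionValues S g x ⊆ optionValues S g′ x
    optionValues-mono eq (s , s∈S , s≤x , u≡) =
      s , s∈S , s≤x , trans u≡ (eq (∸-monoʳ-< (S⊆ℕ₊ s∈S) s≤x))

    isMex-cong : ∀ {g g′ x v} → (∀ {y} → y < x → g y ≡ g′ y) →
                 IsMex (optionValues S g x) v → IsMex (optionValues S g′ x) v
    isMex-cong eq (v∉ , least) =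
      (λ v∈ → v∉ (optionValues-mono (λ y<x → sym (eq y<x)) v∈)) ,
      (λ u u∉ → least u (λ u∈ → u∉ (optionValues-mono eq u∈)))

    IsGSequenceBelow : ℕ → (ℕ → ℕ) → Set ℓ
    IsGSequenceBelow n g = ∀ {x} → x < n → IsMex (optionValues S g x) (g x)

    below-unique : ∀ {n g g′} → IsGSequenceBelow n g → IsGSequenceBelow n g′ →
                   ∀ {x} → x < n → g x ≡ g′ x
    below-unique {n} {g} {g′} p q {x} = <-rec (λ x → x < n → g x ≡ g′ x)
      (λ x rec x<n → isMex-unique
        (isMex-cong (λ y<x → rec y<x (<-trans y<x x<n)) (p x<n)) (q x<n)) x

  gSequence-unique : ∀ {g g′} → IsGSequence S g → IsGSequence S g′ →
                     ∀ x → g x ≡ g′ x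
  gSequence-unique p q x = below-unique {suc x} (λ {y} _ → p y) (λ {y} _ → q y) ≤-refl

  module _ (S? : Decidable S) where

    private
      optionValues? : ∀ g x → Decidable (optionValues S g x)
      optionValues? g x u = map′
        (λ { (s , s<1+x , s∈S , u≡) → s , s∈S , ≤-pred s<1+x , u≡ })
        (λ { (s , s∈S , s≤x , u≡) → s , s≤s s≤x , s∈S , u≡ })
        (anyUpTo? (λ s → S? s ×-dec (u ≟ g (x ∸ s))) (suc x))

      bound : (ℕ → ℕ) → ℕ → ℕ
      bound g zero    = g zero
      bound g (suc x) = bound g x + g (suc x)

      ≤-bound : ∀ g {x y} → y ≤ x → g y ≤ bound g x
      ≤-bound g {zero}  z≤n = ≤-refl
      ≤-bound g {suc x} y≤1+x with m≤n⇒m<n∨m≡n y≤1+x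
      ... | inj₁ y<1+x = ≤-trans (≤-bound g (≤-pred y<1+x)) (m≤m+n _ _)
      ... | inj₂ refl  = m≤n+m _ _

      mex-of-options : ∀ g x → ∃ (IsMex (optionValues S g x))
      mex-of-options g x = isMex-exists (optionValues? g x) {suc (bound g x)}
        λ { (s , _ , _ , eq) →
            <⇒≱ (s≤s (≤-bound g (m∸n≤m x s))) (≤-reflexive eq) }

      update : (ℕ → ℕ) → ℕ → ℕ → ℕ → ℕ
      update g n v x with x ≟ n
      ... | yes _ = v
      ... | no  _ = g x

      update-< : ∀ g {n} v {x} → x < n → g x ≡ update g n v x
      update-< g {n} v {x} x<n with x ≟ n
      ... | yes x≡n = contradiction x≡n (<⇒≢ x<n)
      ... | no  _   = refl

      update-≡ : ∀ g n v → v ≡ update g n v n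
      update-≡ g n v with n ≟ n
      ... | yes _  = refl
      ... | no n≢n = contradiction refl n≢n

      below : ∀ n → ∃ (IsGSequenceBelow n)
      below zero = (λ _ → 0) , λ ()
      below (suc n) with below n
      ... | g , p with mex-of-options g n
      ... | v , isMex = update g n v , q
        where
        q : IsGSequenceBelow (suc n) (update g n v)
        q {x} x<1+n with m≤n⇒m<n∨m≡n (≤-pred x<1+n)
        ... | inj₁ x<n  = subst (IsMex _) (update-< g v x<n)
          (isMex-cong (λ y<x → update-< g v (<-trans y<x x<n)) (p x<n))
        ... | inj₂ refl = subst (IsMex _) (update-≡ g n v)
          (isMex-cong (update-< g v) isMex)

    gSequence-exists : ∃ (IsGSequence S)
    gSequence-exists = g , λ x →
      isMex-cong (λ {y} y<x → agree (<⇒≤ (s≤s y<x)))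
                 (proj₂ (below (suc x)) ≤-refl)
      where
      g : ℕ → ℕ
      g x = proj₁ (below (suc x)) x

      agree : ∀ {x y} → suc y ≤ suc x → proj₁ (below (suc x)) y ≡ g y
      agree {x} {y} y<1+x = below-unique {suc y}
        (λ z<1+y → proj₂ (below (suc x)) (<-≤-trans z<1+y y<1+x))
        (proj₂ (below (suc y))) ≤-refl

′-⊆ℕ₊ : ∀ {S : Pred ℕ ℓ} {h} → S ′[ h ] ⊆ ℕ₊
′-⊆ℕ₊ = proj₁

′-decidable : ∀ {S : Pred ℕ ℓ} h .{{_ : NonZero h}} → Decidable S → Decidable (S ′[ h ])
′-decidable {S = S} h S? n = (0 <? n) ×-dec ¬? (map′
  (λ { (m , _ , m∈ , eq) → m , m∈ , eq })
  (λ { (m , m∈ , eq) → m , s≤s (subst (m ≤_) (sym eq) (m≤m*n m h)) , m∈ , eq })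
  (anyUpTo? (λ m → ((0 <? m) ×-dec ¬? (S? m)) ×-dec (n ≟ m * h)) (suc n)))

{-# OPTIONS --safe #-}

-- Put F n = G (n / h) * h + n % h.  By strong induction it suffices that F n is
-- the mex of the F-values of the options of n in Subtraction(S′).  A heap t < n is
-- such an option, except when t ≡ n (mod h) and n / h − t / h ∉ S.  An option with
-- F t = F n would thus have t ≡ n (mod h) and give an option t / h of n / h in
-- Subtraction(S) with the same G-value.  A value u < F n either has the quotient
-- G (n / h) and a smaller remainder, and is reached by subtracting less than h, or
-- has a quotient G p for an option p of n / h, and is reached at p * h + u % h.
module Submission where

open import Defs
open import Data.Nat using (ℕ; suc; _+_; _*_; _∸_; _≤_; _<_; NonZero)
open import Data.Nat.DivMod
open import Data.Nat.Divisibility using (n∣m*n)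
open import Data.Nat.Induction using (<-rec)
open import Data.Nat.Properties
open import Data.Product using (∃; _×_; _,_; proj₁; proj₂)
open import Data.Sum using (inj₁; inj₂)
open import Level using (Level)
open import Relation.Binary.PropositionalEquality
  using (_≡_; sym; trans; cong; cong₂; subst; module ≡-Reasoning)
open import Relation.Nullary using (¬_; contradiction)
open import Relation.Unary using (Pred; _∈_; _∉_; _⊆_)

private variable
  ℓ : Level

-- Indexing options by the heap `t` reached, not by the amount subtracted, lets quotients and
-- remainders of heaps be compared directly.
optionValues⁺ : ∀ (S : Pred ℕ ℓ) g {x t} → t ≤ x → x ∸ t ∈ S → g t ∈ optionValues S g x
optionValues⁺ S g {x} {t} t≤x x∸t∈S =
  x ∸ t , x∸t∈S , m∸n≤m x t , cong g (sym (m∸[m∸n]≡n t≤x))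

optionValues⁻ : ∀ (S : Pred ℕ ℓ) g {x u} → u ∈ optionValues S g x →
                ∃ λ t → t ≤ x × x ∸ t ∈ S × u ≡ g t
optionValues⁻ S g {x} (s , s∈S , s≤x , u≡) =
  x ∸ s , m∸n≤m x s , subst S (sym (m∸[m∸n]≡n s≤x)) s∈S , u≡

0<∸⇒< : ∀ {m n} → 0 < n ∸ m → m < n
0<∸⇒< {m} {n} 0<n∸m = ≰⇒> λ n≤m → <⇒≢ 0<n∸m (sym (m≤n⇒m∸n≡0 n≤m))

module _ (h : ℕ) .{{_ : NonZero h}} where

  q*h+r≡ : ∀ n → n / h * h + n % h ≡ n
  q*h+r≡ n = trans (+-comm (n / h * h) (n % h)) (sym (m≡m%n+[m/n]*n n h))

  [q*h+r]%h≡r : ∀ q {r} → r < h → (q * h + r) % h ≡ r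
  [q*h+r]%h≡r q {r} r<h = trans (cong (_% h) (+-comm (q * h) r))
    (trans ([m+kn]%n≡m%n r q h) (m<n⇒m%n≡m r<h))

  [q*h+r]/h≡q : ∀ q {r} → r < h → (q * h + r) / h ≡ q
  [q*h+r]/h≡q q {r} r<h = begin
    (q * h + r) / h     ≡⟨ +-distrib-/-∣ˡ r (n∣m*n q) ⟩
    q * h / h + r / h   ≡⟨ cong₂ _+_ (m*n/n≡m q h) (m<n⇒m/n≡0 r<h) ⟩
    q + 0               ≡⟨ +-identityʳ q ⟩
    q                   ∎
    where open ≡-Reasoning

  %≡⇒∸≡* : ∀ {t n} → t % h ≡ n % h → n ∸ t ≡ (n / h ∸ t / h) * h
  %≡⇒∸≡* {t} {n} t%h≡n%h = begin
    n ∸ t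
      ≡⟨ cong₂ _∸_ (m≡m%n+[m/n]*n n h) (m≡m%n+[m/n]*n t h) ⟩
    (n % h + n / h * h) ∸ (t % h + t / h * h)
      ≡⟨ cong (λ r → (n % h + n / h * h) ∸ (r + t / h * h)) t%h≡n%h ⟩
    (n % h + n / h * h) ∸ (n % h + t / h * h)
      ≡⟨ [m+n]∸[m+o]≡n∸o (n % h) (n / h * h) (t / h * h) ⟩
    n / h * h ∸ t / h * h
      ≡⟨ *-distribʳ-∸ h (n / h) (t / h) ⟨
    (n / h ∸ t / h) * h ∎
    where open ≡-Reasoning

  ∸≡*⇒%≡ : ∀ {t n} m → t ≤ n → n ∸ t ≡ m * h → t % h ≡ n % h
  ∸≡*⇒%≡ {t} {n} m t≤n eq = begin
    t % h              ≡⟨ [m+kn]%n≡m%n t m h ⟨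
    (t + m * h) % h    ≡⟨ cong (λ k → (t + k) % h) eq ⟨
    (t + (n ∸ t)) % h  ≡⟨ cong (_% h) (m+[n∸m]≡n t≤n) ⟩
    n % h              ∎
    where open ≡-Reasoning

  module _ (S : Pred ℕ ℓ) where

    -- If `n ∸ t` is `m * h`, the residues agree and `m` is the difference of quotients, so only
    -- that `m` has to be in `S`. With distinct residues the premise is vacuous.
    ∸∈′⁺ : ∀ {t n} → t < n → (t % h ≡ n % h → n / h ∸ t / h ∈ S) → n ∸ t ∈ S ′[ h ]
    ∸∈′⁺ {t} {n} t<n difference∈S = m<n⇒0<n∸m t<n , λ where
      (m , (_ , m∉S) , eq) →
        let t%h≡n%h = ∸≡*⇒%≡ m (<⇒≤ t<n) eq in
        m∉S (subst S (*-cancelʳ-≡ _ m h (trans (sym (%≡⇒∸≡* t%h≡n%h)) eq))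
                     (difference∈S t%h≡n%h))

    -- A double negation is all that results, because `S ′[ h ]` is cut out by removing the
    -- multiples with factor outside `S`.
    ∸∈′⁻ : ∀ {t n} → n ∸ t ∈ S ′[ h ] → t % h ≡ n % h → ¬ (n / h ∸ t / h ∉ S)
    ∸∈′⁻ {t} {n} (0<n∸t , n∸t∉multiples) t%h≡n%h difference∉S =
      n∸t∉multiples
        ( n / h ∸ t / h
        , (*-cancelʳ-< h 0 _ (subst (0 <_) (%≡⇒∸≡* t%h≡n%h) 0<n∸t) , difference∉S)
        , %≡⇒∸≡* t%h≡n%h )

    module _ (S⊆ℕ₊ : S ⊆ ℕ₊) (G : ℕ → ℕ) (G-isGSequence : IsGSequence S G) where

      F : ℕ → ℕ
      F n = G (n / h) * h + n % h

      F-/ : ∀ n → F n / h ≡ G (n / h)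
      F-/ n = [q*h+r]/h≡q (G (n / h)) (m%n<n n h)

      F-% : ∀ n → F n % h ≡ n % h
      F-% n = [q*h+r]%h≡r (G (n / h)) (m%n<n n h)

      F-recompose : ∀ p {r} → r < h → F (p * h + r) ≡ G p * h + r
      F-recompose p r<h =
        cong₂ (λ a b → G a * h + b) ([q*h+r]/h≡q p r<h) ([q*h+r]%h≡r p r<h)

      F-avoids-options : ∀ {t n} → t ≤ n → n ∸ t ∈ S ′[ h ] → ¬ (F n ≡ F t)
      -- The goal is absurdity, so the difference of quotients may be assumed to lie in `S`.
      F-avoids-options {t} {n} t≤n n∸t∈S′ Fn≡Ft = ∸∈′⁻ n∸t∈S′ t%h≡n%h λ difference∈S →
        proj₁ (G-isGSequence (n / h))
          (subst (_∈ optionValues S G (n / h)) (sym Gq≡Gp)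
            (optionValues⁺ S G (/-monoˡ-≤ h t≤n) difference∈S))
        where
        t%h≡n%h : t % h ≡ n % h
        t%h≡n%h = trans (sym (F-% t)) (trans (cong (_% h) (sym Fn≡Ft)) (F-% n))

        Gq≡Gp : G (n / h) ≡ G (t / h)
        Gq≡Gp = trans (sym (F-/ n)) (trans (cong (_/ h) Fn≡Ft) (F-/ t))

      -- Without decidability of S, options with smaller G-values exist only up to ¬¬.
      F-reaches-smaller : ∀ {n u} → u < F n →
                          ¬ (∀ {t} → t < n → n ∸ t ∈ S ′[ h ] → ¬ (u ≡ F t))
      F-reaches-smaller {n} {u} u<Fn unreached
        with m≤n⇒m<n∨m≡n (subst (u / h ≤_) (F-/ n) (/-monoˡ-≤ h (<⇒≤ u<Fn)))
      -- Were `u / h` not an option value, minimality would give `G (n / h) ≤ u / h`; hence it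
      -- suffices to refute each concrete option `p`.
      ... | inj₁ a<Gq = <⇒≱ a<Gq (proj₂ (G-isGSequence (n / h)) (u / h) λ a∈ →
          case-option (optionValues⁻ S G a∈))
        where
        case-option : ¬ (∃ λ p → p ≤ n / h × n / h ∸ p ∈ S × u / h ≡ G p)
        case-option (p , _ , q∸p∈S , a≡Gp) = unreached t<n
          (∸∈′⁺ t<n λ _ → subst (λ k → n / h ∸ k ∈ S) (sym ([q*h+r]/h≡q p r<h)) q∸p∈S)
          (trans (sym (q*h+r≡ u))
            (trans (cong (λ a → a * h + u % h) a≡Gp) (sym (F-recompose p r<h))))
          where
          r<h : u % h < h
          r<h = m%n<n u h

          t<n : p * h + u % h < n
          t<n = begin-strict
            p * h + u % h      <⟨ +-monoʳ-< (p * h) r<h ⟩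
            p * h + h          ≡⟨ +-comm (p * h) h ⟩
            -- Since `S` has only positive elements, `p < n / h`; the whole block of length `h`
            -- gained absorbs the remainder.
            suc p * h          ≤⟨ *-monoˡ-≤ h (0<∸⇒< {p} (S⊆ℕ₊ q∸p∈S)) ⟩
            n / h * h          ≤⟨ m/n*n≤m n h ⟩
            n                  ∎
            where open ≤-Reasoning
      -- The target shares the quotient of `n` but has a smaller residue, so the condition on
      -- quotients is vacuous.
      ... | inj₂ a≡Gq = unreached t<n
          (∸∈′⁺ t<n λ t%h≡n%h → contradiction (trans (sym ([q*h+r]%h≡r (n / h) r<h)) t%h≡n%h)
                                               (<⇒≢ r<n%h))
          (trans u≡ (sym (F-recompose (n / h) r<h)))
        where
        r<h : u % h < h
        r<h = m%n<n u h

        u≡ : u ≡ G (n / h) * h + u % h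
        u≡ = trans (sym (q*h+r≡ u)) (cong (λ a → a * h + u % h) a≡Gq)

        r<n%h : u % h < n % h
        r<n%h = +-cancelˡ-< (G (n / h) * h) _ _ (subst (_< F n) u≡ u<Fn)

        t<n : n / h * h + u % h < n
        t<n = subst (n / h * h + u % h <_) (q*h+r≡ n) (+-monoʳ-< (n / h * h) r<n%h)

      G′≡F : ∀ G′ → IsGSequence (S ′[ h ]) G′ → ∀ n → G′ n ≡ F n
      G′≡F G′ G′-isGSequence = <-rec (λ n → G′ n ≡ F n) λ n rec →
        isMex-unique (G′-isGSequence n)
          ( (λ Fn∈ →
              let t , t≤n , n∸t∈S′ , Fn≡G′t = optionValues⁻ (S ′[ h ]) G′ Fn∈ in
              F-avoids-options t≤n n∸t∈S′
                -- Positivity of the amount subtracted gives `t < n`, as the induction hypothesis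
                -- requires.
                (trans Fn≡G′t (rec (0<∸⇒< (proj₁ n∸t∈S′)))))
          -- Order on ℕ is decidable, so refuting `u < F n` is enough, and the doubly negated
          -- reachability suffices.
          , λ u u∉ → ≮⇒≥ λ u<Fn → F-reaches-smaller u<Fn λ t<n n∸t∈S′ u≡Ft →
              u∉ (subst (_∈ optionValues (S ′[ h ]) G′ n)
                        (trans (rec t<n) (sym u≡Ft))
                        (optionValues⁺ (S ′[ h ]) G′ (<⇒≤ t<n) n∸t∈S′)) )

theorem2p2 : ∀ {ℓ : Level} (h : ℕ) .{{_ : NonZero h}} (S : Pred ℕ ℓ) → S ⊆ ℕ₊ →
    (G G′ : ℕ → ℕ) → IsGSequence S G → IsGSequence (S ′[ h ]) G′ →
    ∀ (n : ℕ) → G′ n ≡ G (n / h) * h + n % h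
theorem2p2 h S S⊆ℕ₊ G G′ G-isGSequence G′-isGSequence =
  G′≡F h S S⊆ℕ₊ G G-isGSequence G′ G′-isGSequence
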